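{- If $G$ is a randomly $3$-dimensional graph, then $G$ is $3$-connected.
   Context: All graphs are finite, simple and connected. A graph is $k$-connected if every separating set (a vertex set whose removal leaves at least two components) has at least $k$ vertices. For an ordered set $W=\{w_1,\dots,w_k\}\subseteq V(G)$ and $v\in V(G)$, $r(v|W)=(d(v,w_1),\dots,d(v,w_k))$, where $d$ denotes graph distance. $W$ is a resolving set if distinct vertices have distinct representations with respect to $W$; a basis is a minimum-size resolving set and its size is the metric dimension $\beta(G)$. $G$ is randomly $k$-dimensional if $\beta(G)=k$ and every $k$-subset of $V(G)$ is a basis of $G$. -}

module Defs where

open import Level using (0ℓ)
open import Data.Nat using (ℕ; zero; suc; _<_; _≤_)
open import Data.Fin using (Fin)
open import Data.Fin.Subset using (Subset; _∈_; _∉_; ∣_∣)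
open import Data.Product using (Σ; ∃; ∃-syntax; _×_)
open import Relation.Nullary using (¬_)
open import Relation.Binary.PropositionalEquality using (_≡_; _≢_)

record Graph : Set₁ where
  field
    n     : ℕ
    Adj   : Fin n → Fin n → Set
    sym   : ∀ {u v} → Adj u v → Adj v u
    irrefl : ∀ {u} → ¬ Adj u u
open Graph public

module _ (G : Graph) where

  data Walk : Fin (n G) → Fin (n G) → ℕ → Set where
    nil  : ∀ {u} → Walk u u zero
    cons : ∀ {u w v k} → Adj G u w → Walk w v k → Walk u v (suc k)

  Dist : Fin (n G) → Fin (n G) → ℕ → Set
  Dist u v k = Walk u v k × (∀ m → m < k → ¬ Walk u v m)

  Connected : Set
  Connected = ∀ u v → ∃[ k ] Walk u v k

  SameDist : Fin (n G) → Fin (n G) → Fin (n G) → Set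
  SameDist u v w = ∃[ k ] (Dist u w k × Dist v w k)

  SameRep : Subset (n G) → Fin (n G) → Fin (n G) → Set
  SameRep W u v = ∀ w → w ∈ W → SameDist u v w

  Resolving : Subset (n G) → Set
  Resolving W = ∀ u v → u ≢ v → ¬ SameRep W u v

  IsBasis : Subset (n G) → Set
  IsBasis W = Resolving W × (∀ W′ → Resolving W′ → ∣ W ∣ ≤ ∣ W′ ∣)

  MetricDim : ℕ → Set
  MetricDim k = ∃[ W ] (IsBasis W × ∣ W ∣ ≡ k)

  RandomlyDim : ℕ → Set
  RandomlyDim k = MetricDim k × (∀ W → ∣ W ∣ ≡ k → IsBasis W)

  data WalkAvoid (S : Subset (n G)) : Fin (n G) → Fin (n G) → Set where
    nil  : ∀ {u} → u ∉ S → WalkAvoid S u u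
    cons : ∀ {u w v} → u ∉ S → Adj G u w → WalkAvoid S w v → WalkAvoid S u v

  Separating : Subset (n G) → Set
  Separating S = ∃[ u ] ∃[ v ] (u ∉ S × v ∉ S × ¬ WalkAvoid S u v)

  KConnected : ℕ → Set
  KConnected k = ∀ S → Separating S → k ≤ ∣ S ∣

{-# OPTIONS --safe #-}
module Submission where

-- Being randomly 3-dimensional means: (A) two distinct vertices are equidistant from at most two vertices,
-- and (B) for any a, b some two distinct vertices are equidistant from both a and b. By (A) and counting, the
-- pair in (B) is determined by {a , b}. A pair that a leaf and a third vertex fail to resolve violates (A) at
-- the neighbour of the leaf; a finer argument of this kind excludes degree two, so all degrees are at least
-- three. Suppose now that {x , y} separates two sides, and give each vertex h the coordinates
-- (d h x , d h y); by (A) they determine h within its side. Since degrees are at least three, each side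
-- contains two vertices at the same distance from x, and two at the same distance from y. For u , v on one
-- side with d u x ≡ d v x and d u y < d v y, every h on the other side with d u x + d h x ≤ d u y + d h y is
-- equidistant from u and v, so by (A) there is at most one such h. These constraints leave few coordinates:
-- if x and y are adjacent, more than two vertices are equidistant from x and y, contradicting (A); if they
-- are not, then d x y ≡ 2 and some vertex maximising d h x + d h y on a side has degree at most two.
-- Smaller separating sets are enlarged to two vertices. As the conclusion is decidable, distances and
-- reachability may be assumed decidable even though adjacency need not be.

open import Defs renaming (sym to Adj-sym; n to order)
open import Data.Bool using (Bool; true; false)
open import Data.Bool.Properties as Bool using ()
open import Data.Empty using (⊥; ⊥-elim)
open import Data.Fin using (Fin; zero; suc; combine; remQuot; punchOut)
open import Data.Fin.Properties as Fin using (any?)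
open import Data.Fin.Subset using (Subset; _∈_; _∉_; ∣_∣; ⁅_⁆; _∪_)
open import Data.Fin.Subset.Properties
  using (_∈?_; x∈⁅x⁆; x∈⁅y⁆⇒x≡y; ∣⁅x⁆∣≡1; p⊂q⇒∣p∣<∣q∣; p⊆q⇒∣p∣≤∣q∣; p⊆p∪q; q⊆p∪q; x∈p∪q⁻; x∈p∪q⁺)
open import Data.List using (List; []; _∷_; filter; allFin)
open import Data.List.Membership.Propositional.Properties using (∈-filter⁺; ∈-allFin)
open import Data.List.Relation.Unary.All as All using (All; []; _∷_)
open import Data.List.Relation.Unary.All.Properties using (all-filter)
open import Data.Nat using (ℕ; zero; suc; _+_; _*_; _⊓_; _≤_; _<_; z≤n; s≤s)
open import Data.Nat.Induction using (<-rec)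
open import Data.Nat.Properties
open import Data.List.Extrema ≤-totalOrder using (argmax; argmax-all; f[xs]≤f[argmax])
open import Data.Nat.Solver using (module +-*-Solver)
open import Data.Product using (∃; ∃-syntax; ∃₂; _×_; _,_; proj₁; proj₂; swap; uncurry)
open import Data.Sum as Sum using (_⊎_; inj₁; inj₂)
open import Data.Vec using (Vec; []; _∷_; lookup; replicate; zipWith)
open import Data.Vec.Relation.Binary.Pointwise.Inductive as Pointwise using (Pointwise; []; _∷_)
open import Function using (_∘_)
open import Function.Definitions using (Injective)
open import Relation.Binary.Definitions using (tri<; tri≈; tri>)
open import Relation.Binary.PropositionalEquality
  using (_≡_; _≢_; refl; sym; trans; cong; cong₂; subst; subst₂; ≢-sym)
open import Relation.Nullary using (¬_; Dec; yes; no; does; contradiction)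
open import Relation.Nullary.Decidable
  using (True; toWitness; _×-dec_; ¬?; decidable-stable; ¬¬-excluded-middle; dec-true; dec-false)
open import Relation.Unary using (Decidable)

-- Linear arithmetic over ℕ

infixl 8 _⊕_
infix 7 _≲_

data Exp (k : ℕ) : Set where
  con : ℕ → Exp k
  var : Fin k → Exp k
  _⊕_ : Exp k → Exp k → Exp k

record Ineq (k : ℕ) : Set where
  constructor _≲_
  field
    lower upper : Exp k
open Ineq

v₀ : ∀ {k} → Exp (1 + k)
v₀ = var zero
v₁ : ∀ {k} → Exp (2 + k)
v₁ = var (suc zero)
v₂ : ∀ {k} → Exp (3 + k)
v₂ = var (suc (suc zero))
v₃ : ∀ {k} → Exp (4 + k)
v₃ = var (suc (suc (suc zero)))
v₄ : ∀ {k} → Exp (5 + k)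
v₄ = var (suc (suc (suc (suc zero))))
v₅ : ∀ {k} → Exp (6 + k)
v₅ = var (suc (suc (suc (suc (suc zero)))))

⟦_⟧ : ∀ {k} → Exp k → Vec ℕ k → ℕ
⟦ con c ⟧ ρ = c
⟦ var i ⟧ ρ = lookup ρ i
⟦ e ⊕ f ⟧ ρ = ⟦ e ⟧ ρ + ⟦ f ⟧ ρ

Holds : ∀ {k} → Vec ℕ k → Ineq k → Set
Holds ρ (e ≲ f) = ⟦ e ⟧ ρ ≤ ⟦ f ⟧ ρ

dot : ∀ {k} → Vec ℕ k → Vec ℕ k → ℕ
dot []       []       = 0
dot (a ∷ as) (b ∷ bs) = a * b + dot as bs

unit : ∀ {k} → Fin k → Vec ℕ k
unit zero    = 1 ∷ replicate _ 0
unit (suc i) = 0 ∷ unit i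

-- The head holds the constant term, to be paired with the leading `1` of the environment `1 ∷ ρ`.
coefficients : ∀ {k} → Exp k → Vec ℕ (suc k)
coefficients (con c) = c ∷ replicate _ 0
coefficients (var i) = 0 ∷ unit i
coefficients (e ⊕ f) = zipWith _+_ (coefficients e) (coefficients f)

dot-zero : ∀ {k} (ρ : Vec ℕ k) → dot (replicate k 0) ρ ≡ 0
dot-zero []      = refl
dot-zero (_ ∷ ρ) = dot-zero ρ

dot-unit : ∀ {k} (i : Fin k) (ρ : Vec ℕ k) → dot (unit i) ρ ≡ lookup ρ i
dot-unit zero    (b ∷ ρ) rewrite dot-zero ρ = trans (+-identityʳ (b + 0)) (+-identityʳ b)
dot-unit (suc i) (_ ∷ ρ) = dot-unit i ρ

dot-+ : ∀ {k} (as bs ρ : Vec ℕ k) → dot (zipWith _+_ as bs) ρ ≡ dot as ρ + dot bs ρ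
dot-+ []       []       []      = refl
dot-+ (a ∷ as) (b ∷ bs) (r ∷ ρ) rewrite dot-+ as bs ρ =
  solve 5 (λ a b r s t → (a :+ b) :* r :+ (s :+ t) := (a :* r :+ s) :+ (b :* r :+ t))
    refl a b r (dot as ρ) (dot bs ρ)
  where open +-*-Solver

dot-mono : ∀ {k} {as bs : Vec ℕ k} (ρ : Vec ℕ k) → Pointwise _≤_ as bs → dot as ρ ≤ dot bs ρ
dot-mono []      []         = z≤n
dot-mono (r ∷ ρ) (le ∷ les) = +-mono-≤ (*-monoˡ-≤ r le) (dot-mono ρ les)

dot-coefficients : ∀ {k} (e : Exp k) (ρ : Vec ℕ k) → dot (coefficients e) (1 ∷ ρ) ≡ ⟦ e ⟧ ρ
dot-coefficients (con c) ρ rewrite dot-zero ρ = trans (+-identityʳ (c * 1)) (*-identityʳ c)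
dot-coefficients (var i) ρ = dot-unit i ρ
dot-coefficients (e ⊕ f) ρ =
  trans (dot-+ (coefficients e) (coefficients f) (1 ∷ ρ))
        (cong₂ _+_ (dot-coefficients e ρ) (dot-coefficients f ρ))

total : ∀ {k} → List (Ineq k) → Ineq k
total []               = con 0 ≲ con 0
total ((e ≲ f) ∷ hyps) = e ⊕ lower (total hyps) ≲ f ⊕ upper (total hyps)

total-holds : ∀ {k} {ρ : Vec ℕ k} {hyps} → All (Holds ρ) hyps → Holds ρ (total hyps)
total-holds []       = z≤n
total-holds (p ∷ ps) = +-mono-≤ p (total-holds ps)

-- The sum L ≤ R of the hypotheses yields the goal e ≤ f as soon as R + e ≤ L + f holds coefficientwise.
linear : ∀ {k} (ρ : Vec ℕ k) (hyps : List (Ineq k)) (goal : Ineq k) →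
  {True (Pointwise.decidable _≤?_ (coefficients (upper (total hyps) ⊕ lower goal))
                                  (coefficients (lower (total hyps) ⊕ upper goal)))} →
  All (Holds ρ) hyps → Holds ρ goal
linear ρ hyps (e ≲ f) {t} ps = +-cancelˡ-≤ (⟦ upper (total hyps) ⟧ ρ) _ _
  (≤-trans step (+-monoˡ-≤ (⟦ f ⟧ ρ) (total-holds ps)))
  where
  step : ⟦ upper (total hyps) ⟧ ρ + ⟦ e ⟧ ρ ≤ ⟦ lower (total hyps) ⟧ ρ + ⟦ f ⟧ ρ
  step = subst₂ _≤_ (dot-coefficients (upper (total hyps) ⊕ e) ρ) (dot-coefficients (lower (total hyps) ⊕ f) ρ)
           (dot-mono (1 ∷ ρ) (toWitness t))

-- Finite sets

injective⇒surjective : ∀ {m} (f : Fin m → Fin m) → Injective _≡_ _≡_ f → ∀ j → ∃[ i ] f i ≡ j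
injective⇒surjective {suc m} f inj j with any? (λ i → f i Fin.≟ j)
... | yes hit = hit
... | no miss = contradiction (Fin.injective⇒≤ {f = λ i → punchOut (j≢f i)}
  (λ {i} {i′} eq → inj (Fin.punchOut-injective (j≢f i) (j≢f i′) eq))) 1+n≰n
  where
  j≢f : ∀ i → j ≢ f i
  j≢f i j≡fi = miss (i , sym j≡fi)

-- Opaque, like the other searches below: with-abstraction over a witness would otherwise unfold its search.
opaque
  maximum : ∀ {n} {P : Fin n → Set} → Decidable P → (f : Fin n → ℕ) → ∃ P →
    ∃[ t ] (P t × (∀ {h} → P h → f h ≤ f t))
  maximum {n} P? f (p , Pp) =
    argmax f p candidates , argmax-all f Pp (all-filter P? (allFin n)) ,
    λ Ph → All.lookup (f[xs]≤f[argmax] {f = f} p candidates) (∈-filter⁺ P? (∈-allFin _) Ph)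
    where
    candidates : List (Fin n)
    candidates = filter P? (allFin n)

-- Metrics in which all triples of vertices resolve and no pair does

module RandomlyThreeDimensional
  {n : ℕ} (d : Fin n → Fin n → ℕ)
  (d-refl : ∀ u → d u u ≡ 0)
  (d≡0⇒≡ : ∀ {u v} → d u v ≡ 0 → u ≡ v)
  (d-sym : ∀ u v → d u v ≡ d v u)
  (d-triangle : ∀ u v w → d u w ≤ d u v + d v w)
  (d-step : ∀ {u v k} → d u v ≡ suc k → ∃[ w ] (d u w ≡ 1 × d w v ≡ k))
  (triple-resolves : ∀ {u v a b c} → u ≢ v → a ≢ b → a ≢ c → b ≢ c →
    d u a ≡ d v a → d u b ≡ d v b → d u c ≡ d v c → ⊥)
  (unresolved : ∀ a b → ∃₂ λ u v → u ≢ v × d u a ≡ d v a × d u b ≡ d v b)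
  where

  V : Set
  V = Fin n

  d-adjacent : ∀ {u e} v → d u e ≡ 1 → d u v ≤ suc (d e v)
  d-adjacent {u} {e} v ue = subst (λ k → d u v ≤ k + d e v) ue (d-triangle u e v)

  adj⇒≢ : ∀ {u e} → d u e ≡ 1 → u ≢ e
  adj⇒≢ {u} ue refl with () ← trans (sym ue) (d-refl u)

  ≢⇒0<d : ∀ {u v} → u ≢ v → 0 < d u v
  ≢⇒0<d u≢v = n≢0⇒n>0 (u≢v ∘ d≡0⇒≡)

  equidistant-≢ : ∀ {u v a} → u ≢ v → d u a ≡ d v a → u ≢ a
  equidistant-≢ {u} u≢v eq refl = u≢v (sym (d≡0⇒≡ (trans (sym eq) (d-refl u))))

  first-step : ∀ {u v} → u ≢ v → ∃[ e ] (d u e ≡ 1 × d u v ≡ suc (d e v))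
  first-step {u} {v} u≢v with d u v in eq
  ... | zero  = contradiction (d≡0⇒≡ eq) u≢v
  ... | suc k with e , ue , ev ← d-step eq = e , ue , cong suc (sym ev)

  -- Sending {a , b} to a pair it does not resolve is injective, hence bijective on the finite set of pairs;
  -- ordered pairs are used, with pair b a the reversal of pair a b.
  module PairCount where

    record Unresolved (a b s t : V) : Set where
      field
        s≢t : s ≢ t
        eqa : d s a ≡ d t a
        eqb : d s b ≡ d t b
    open Unresolved

    -- Fixing the diagonal makes this a self-map of all of `V × V`, which can be coded as a self-map
    -- of `Fin (n * n)`.
    pair : V → V → V × V
    pair a b with Fin.<-cmp a b
    ... | tri< _ _ _ = let s , t , _ = unresolved a b in s , t
    ... | tri≈ _ _ _ = a , a
    ... | tri> _ _ _ = let s , t , _ = unresolved b a in t , s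

    pair-diagonal : ∀ a → pair a a ≡ (a , a)
    pair-diagonal a with Fin.<-cmp a a
    ... | tri< _ a≢a _ = contradiction refl a≢a
    ... | tri≈ _ _ _   = refl
    ... | tri> _ a≢a _ = contradiction refl a≢a

    pair-spec : ∀ {a b} → a ≢ b → uncurry (Unresolved a b) (pair a b)
    pair-spec {a} {b} a≢b with Fin.<-cmp a b
    ... | tri< _ _ _   = let _ , _ , s≢t , ea , eb = unresolved a b in
                         record { s≢t = s≢t ; eqa = ea ; eqb = eb }
    ... | tri≈ _ a≡b _ = contradiction a≡b a≢b
    ... | tri> _ _ _   = let _ , _ , s≢t , eb , ea = unresolved b a in
                         record { s≢t = ≢-sym s≢t ; eqa = sym ea ; eqb = sym eb }

    pair-swap : ∀ a b → pair b a ≡ swap (pair a b)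
    pair-swap a b with Fin.<-cmp a b | Fin.<-cmp b a
    ... | tri< _ _ _     | tri> _ _ _     = refl
    ... | tri> _ _ _     | tri< _ _ _     = refl
    ... | tri≈ _ a≡b _   | tri≈ _ _ _     = cong₂ _,_ (sym a≡b) (sym a≡b)
    ... | tri< a<b _ _   | tri< _ _ a≮b   = contradiction a<b a≮b
    ... | tri< _ a≢b _   | tri≈ _ b≡a _   = contradiction (sym b≡a) a≢b
    ... | tri≈ _ a≡b _   | tri< _ b≢a _   = contradiction (sym a≡b) b≢a
    ... | tri≈ _ a≡b _   | tri> _ b≢a _   = contradiction (sym a≡b) b≢a
    ... | tri> _ a≢b _   | tri≈ _ b≡a _   = contradiction (sym b≡a) a≢b
    ... | tri> _ _ b<a   | tri> b≮a _ _   = contradiction b<a b≮a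

    -- Otherwise `a`, `b` and `a′` would be three vertices that do not resolve `s` and `t`.
    spec-∈ : ∀ {a b a′ b′ s t} → a ≢ b → Unresolved a b s t → Unresolved a′ b′ s t → a′ ≡ a ⊎ a′ ≡ b
    spec-∈ {a} {b} {a′} a≢b p q with a′ Fin.≟ a | a′ Fin.≟ b
    ... | yes eq | _      = inj₁ eq
    ... | no _   | yes eq = inj₂ eq
    ... | no ne  | no ne′ =
      ⊥-elim (triple-resolves (s≢t p) a≢b (≢-sym ne) (≢-sym ne′) (eqa p) (eqb p) (eqa q))

    spec-swap : ∀ {a b s t} → Unresolved a b s t → Unresolved b a s t
    spec-swap p = record { s≢t = s≢t p ; eqa = eqb p ; eqb = eqa p }

    spec-unique : ∀ {a b a′ b′ s t} → a ≢ b → a′ ≢ b′ → Unresolved a b s t → Unresolved a′ b′ s t →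
      (a′ ≡ a × b′ ≡ b) ⊎ (a′ ≡ b × b′ ≡ a)
    spec-unique a≢b a′≢b′ p q with spec-∈ a≢b p q | spec-∈ a≢b p (spec-swap q)
    ... | inj₁ refl | inj₁ refl = contradiction refl a′≢b′
    ... | inj₁ e    | inj₂ e′   = inj₁ (e , e′)
    ... | inj₂ e    | inj₁ e′   = inj₂ (e , e′)
    ... | inj₂ refl | inj₂ refl = contradiction refl a′≢b′

    pair-injective : ∀ {a b a′ b′} → pair a b ≡ pair a′ b′ → (a , b) ≡ (a′ , b′)
    pair-injective {a} {b} {a′} {b′} eq with a Fin.≟ b | a′ Fin.≟ b′
    ... | yes refl | yes refl = trans (sym (pair-diagonal a)) (trans eq (pair-diagonal a′))
    ... | yes refl | no a′≢b′ =
      contradiction refl (s≢t (subst (uncurry (Unresolved a′ b′)) (trans (sym eq) (pair-diagonal a)) (pair-spec a′≢b′)))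
    ... | no a≢b | yes refl =
      contradiction refl (s≢t (subst (uncurry (Unresolved a b)) (trans eq (pair-diagonal a′)) (pair-spec a≢b)))
    ... | no a≢b | no a′≢b′
      with spec-unique a≢b a′≢b′ (pair-spec a≢b) (subst (uncurry (Unresolved a′ b′)) (sym eq) (pair-spec a′≢b′))
    ... | inj₁ (e , e′) = cong₂ _,_ (sym e) (sym e′)
    -- Here `pair a b` would equal its own reversal, although its components differ.
    ... | inj₂ (refl , refl) =
      contradiction (cong proj₁ (trans eq (pair-swap a b))) (s≢t (pair-spec a≢b))

    pair-surjective : ∀ s t → ∃₂ λ a b → pair a b ≡ (s , t)
    pair-surjective s t =
      let i , eq = injective⇒surjective f f-injective (combine s t)
          a , b  = remQuot {n} n i
      in a , b , trans (sym (Fin.remQuot-combine (proj₁ (pair a b)) _))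
           (trans (cong (remQuot {n} n) eq) (Fin.remQuot-combine s t))
      where
      f : Fin (n * n) → Fin (n * n)
      f i = uncurry combine (uncurry pair (remQuot {n} n i))
      f-injective : Injective _≡_ _≡_ f
      f-injective {i} {j} eq =
        trans (sym (Fin.combine-remQuot {n} n i))
          (trans (cong (uncurry combine)
            (pair-injective
              (trans (sym (Fin.remQuot-combine {n} {n} _ _))
                (trans (cong (remQuot {n} n) eq) (Fin.remQuot-combine {n} {n} _ _)))))
          (Fin.combine-remQuot {n} n j))

    preimage : ∀ {a b s t} → a ≢ b → Unresolved a b s t → pair a b ≡ (s , t) ⊎ pair b a ≡ (s , t)
    preimage {s = s} {t} a≢b p with pair-surjective s t
    ... | a′ , b′ , eq with a′ Fin.≟ b′
    ... | yes refl = contradiction (trans (cong proj₁ diagonal) (sym (cong proj₂ diagonal))) (s≢t p)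
      where
      diagonal : (s , t) ≡ (a′ , a′)
      diagonal = trans (sym eq) (pair-diagonal a′)
    ... | no a′≢b′ with spec-unique a≢b a′≢b′ p (subst (uncurry (Unresolved a′ b′)) eq (pair-spec a′≢b′))
    ... | inj₁ (refl , refl) = inj₁ eq
    ... | inj₂ (refl , refl) = inj₂ eq

    -- By surjectivity both unresolved pairs are values of `pair`; the arguments can only be `a , b`
    -- or `b , a`, whose values are reversals of each other.
    unresolved-unique : ∀ {a b s t s′ t′} → a ≢ b → Unresolved a b s t → Unresolved a b s′ t′ → s ≡ s′ ⊎ s ≡ t′
    unresolved-unique {a} {b} a≢b p q with preimage a≢b p | preimage a≢b q
    ... | inj₁ e | inj₁ e′ = inj₁ (cong proj₁ (trans (sym e) e′))
    ... | inj₂ e | inj₂ e′ = inj₁ (cong proj₁ (trans (sym e) e′))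
    ... | inj₁ e | inj₂ e′ = inj₂ (cong proj₁ (trans (sym e) (trans (pair-swap b a) (cong swap e′))))
    ... | inj₂ e | inj₁ e′ = inj₂ (cong proj₁ (trans (sym e) (trans (pair-swap a b) (cong swap e′))))

  -- Minimum degree at least three

  -- A pair not resolved by a leaf c and another vertex is not resolved by the neighbour of c either.
  not-leaf : ∀ c a → ¬ (∀ e → d c e ≡ 1 → e ≡ a)
  not-leaf c a only-a
    with r , r′ , r≢r′ , rc , ra ← unresolved c a
    with s , t , s≢t , sc , sr ← unresolved c r
    = triple-resolves s≢t (≢-sym (equidistant-≢ r≢r′ rc)) (adj⇒≢ ca) (equidistant-≢ r≢r′ ra) sc sr
        (suc-injective (trans (sym (through (equidistant-≢ s≢t sc)))
          (trans sc (through (equidistant-≢ (≢-sym s≢t) (sym sc))))))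
    where
    through : ∀ {u} → u ≢ c → d u c ≡ suc (d u a)
    through {u} u≢c with first-step (≢-sym u≢c)
    ... | e , ce , eq rewrite only-a e ce = trans (d-sym u c) (trans eq (cong suc (d-sym a u)))
    ca : d c a ≡ 1
    ca with r , r′ , r≢r′ , rc , _ ← unresolved c c
      with e , ce , _ ← first-step (≢-sym (equidistant-≢ r≢r′ rc)) = subst (λ e → d c e ≡ 1) (only-a e ce) ce

  -- Names such as no-31 and vertex-21 refer to the coordinates (d h x , d h y) of a vertex h.
  module DegreeTwo
    (c x y : V) (x≢y : x ≢ y) (cx : d c x ≡ 1) (cy : d c y ≡ 1)
    (only-xy : ∀ e → d c e ≡ 1 → e ≡ x ⊎ e ≡ y)
    where

    c≢x : c ≢ x
    c≢x = adj⇒≢ cx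

    c≢y : c ≢ y
    c≢y = adj⇒≢ cy

    -- A geodesic out of `c` begins at `x` or `y`, necessarily at one that is nearest to `u`.
    d-c : ∀ {u} → u ≢ c → d u c ≡ suc (d u x ⊓ d u y)
    d-c {u} u≢c with first-step (≢-sym u≢c)
    ... | e , ce , eq with only-xy e ce
    ... | inj₁ refl = trans (d-sym u c) (trans eq (cong suc
            (trans (d-sym x u) (sym (m≤n⇒m⊓n≡m (subst (_≤ d u y) (d-sym x u) (subst (d x u ≤_) (d-sym y u)
              (≤-pred (subst (_≤ suc (d y u)) eq (d-adjacent u cy))))))))))
    ... | inj₂ refl = trans (d-sym u c) (trans eq (cong suc
            (trans (d-sym y u) (sym (m≥n⇒m⊓n≡n (subst (_≤ d u x) (d-sym y u) (subst (d y u ≤_) (d-sym x u)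
              (≤-pred (subst (_≤ suc (d x u)) eq (d-adjacent u cx))))))))))

    equidistant-c : ∀ {s t} → s ≢ c → t ≢ c → d s x ≡ d t x → d s y ≡ d t y → d s c ≡ d t c
    equidistant-c s≢c t≢c ex ey = trans (d-c s≢c) (trans (cong suc (cong₂ _⊓_ ex ey)) (sym (d-c t≢c)))

    equal-minimum : ∀ {s t} → s ≢ t → d s c ≡ d t c → d s x ⊓ d s y ≡ d t x ⊓ d t y
    equal-minimum s≢t ec = suc-injective
      (trans (sym (d-c (equidistant-≢ s≢t ec))) (trans ec (d-c (equidistant-≢ (≢-sym s≢t) (sym ec)))))

    -- By `d-c`, equal distances from `x` and `y` force equal distances from `c`, so `x`, `y` and
    -- `c` would not resolve distinct `s` and `t`.
    rep-injective : ∀ {s t} → s ≢ c → t ≢ c → d s x ≡ d t x → d s y ≡ d t y → s ≡ t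
    rep-injective {s} {t} s≢c t≢c ex ey with s Fin.≟ t
    ... | yes s≡t = s≡t
    ... | no  s≢t = ⊥-elim (triple-resolves s≢t x≢y (≢-sym c≢x) (≢-sym c≢y) ex ey (equidistant-c s≢c t≢c ex ey))

    -- A pair not resolved by `x` and `y` must contain `c`, by `rep-injective`; its other member
    -- shares the coordinates (1 , 1) of `c`.
    twin : ∃[ v ] (v ≢ c × d v x ≡ 1 × d v y ≡ 1)
    twin with unresolved x y
    ... | s , t , s≢t , ex , ey with s Fin.≟ c | t Fin.≟ c
    ... | yes refl | _        = t , ≢-sym s≢t , trans (sym ex) cx , trans (sym ey) cy
    ... | no _     | yes refl = s , s≢t , trans ex cx , trans ey cy
    ... | no s≢c   | no t≢c   = contradiction (rep-injective s≢c t≢c ex ey) s≢t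

    v : V
    v = proj₁ twin

    v≢c : v ≢ c
    v≢c = proj₁ (proj₂ twin)

    vx : d v x ≡ 1
    vx = proj₁ (proj₂ (proj₂ twin))

    vy : d v y ≡ 1
    vy = proj₂ (proj₂ (proj₂ twin))

    -- Both `c` and `v` are equidistant from `x` and `y`, so a further such vertex would be the
    -- third.
    diagonal : ∀ {h} → h ≢ c → d h x ≡ d h y → h ≡ v
    diagonal {h} h≢c eq with h Fin.≟ v
    ... | yes h≡v = h≡v
    ... | no  h≢v = ⊥-elim (triple-resolves x≢y (≢-sym v≢c) (≢-sym h≢c) (≢-sym h≢v)
      (xy-equidistant (trans cx (sym cy))) (xy-equidistant (trans vx (sym vy))) (xy-equidistant eq))
      where
      xy-equidistant : ∀ {a} → d a x ≡ d a y → d x a ≡ d y a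
      xy-equidistant {a} e = trans (d-sym x a) (trans e (d-sym a y))

    gap≤2 : ∀ h → d h x ≤ d h y + 2
    gap≤2 h = ≤-trans (d-triangle h y x) (+-monoʳ-≤ (d h y) (≤-trans (d-triangle y c x)
      (≤-reflexive (cong₂ _+_ (trans (d-sym y c) cy) cx))))

    module _ (no-31 : ∀ h → d h x ≡ 3 → d h y ≢ 1) where

      -- By `gap≤2`, a step towards `y` preserves a gap of two, so descent would reach a vertex with
      -- coordinates (3 , 1).
      no-gap-2 : ∀ i h → d h y ≡ suc i → d h x ≢ 3 + i
      no-gap-2 zero    h hy hx = no-31 h hx hy
      no-gap-2 (suc i) h hy hx with d-step hy
      ... | e , he , ey = no-gap-2 i e ey (≤-antisym
        (linear (d e x ∷ d e y ∷ i ∷ []) (v₀ ≲ v₁ ⊕ con 2 ∷ v₁ ≲ con 1 ⊕ v₂ ∷ []) (v₀ ≲ con 3 ⊕ v₂)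
          (gap≤2 e ∷ ≤-reflexive ey ∷ []))
        (≤-pred (subst (_≤ suc (d e x)) hx (d-adjacent x he))))

      gap≡1 : ∀ {h} → h ≢ y → d h y < d h x → d h x ≡ suc (d h y)
      gap≡1 {h} h≢y lt with d h y in hy
      ... | zero  = contradiction (d≡0⇒≡ hy) h≢y
      ... | suc i = ≤-antisym (≤-pred (≤∧≢⇒< x≤3+i (no-gap-2 i h hy))) lt
        where
        x≤3+i : d h x ≤ 3 + i
        x≤3+i = ≤-trans (gap≤2 h) (≤-reflexive (trans (cong (_+ 2) hy) (+-comm (suc i) 2)))

      -- Members of a pair not resolved by `c` and `y` agree in their distance from `y` and in their
      -- smaller coordinate. The one nearer `x` then lies on the diagonal, so it is `v`, and the
      -- other is the vertex sought.
      vertex-21 : ∃[ w ] (d w x ≡ 2 × d w y ≡ 1)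
      vertex-21 = by-order (unresolved c y)
        where
        ordered : ∀ {s t} → s ≢ t → d s c ≡ d t c → d s y ≡ d t y → d s x < d t x → d t x ≡ 2 × d t y ≡ 1
        ordered {s} {t} s≢t ec ey lt = trans tx (cong suc ty) , ty
          where
          y≤x : d s y ≤ d s x
          y≤x = ≮⇒≥ λ x<y → <⇒≢ (≤-trans (s≤s (m⊓n≤m (d s x) (d s y))) (⊓-glb lt (subst (d s x <_) ey x<y)))
                  (equal-minimum s≢t ec)
          tx : d t x ≡ suc (d t y)
          tx = gap≡1 (equidistant-≢ (≢-sym s≢t) (sym ey)) (subst (_< d t x) ey (≤-<-trans y≤x lt))
          s≡v : s ≡ v
          s≡v = diagonal (equidistant-≢ s≢t ec)
                  (≤-antisym (subst (d s x ≤_) (sym ey) (≤-pred (subst (d s x <_) tx lt))) y≤x)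
          ty : d t y ≡ 1
          ty = trans (sym ey) (trans (cong (λ s → d s y) s≡v) vy)
        by-order : (∃₂ λ s t → s ≢ t × d s c ≡ d t c × d s y ≡ d t y) → ∃[ w ] (d w x ≡ 2 × d w y ≡ 1)
        by-order (s , t , s≢t , ec , ey) with <-cmp (d s x) (d t x)
        ... | tri< lt _ _ = t , ordered s≢t ec ey lt
        ... | tri> _ _ gt = s , ordered (≢-sym s≢t) (sym ec) (sym ey) gt
        ... | tri≈ _ ex _ =
          contradiction (rep-injective (equidistant-≢ s≢t ec) (equidistant-≢ (≢-sym s≢t) (sym ec)) ex ey) s≢t

      w : V
      w = proj₁ vertex-21

      wx : d w x ≡ 2
      wx = proj₁ (proj₂ vertex-21)

      wy : d w y ≡ 1
      wy = proj₂ (proj₂ vertex-21)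

      -- A geodesic towards `y` keeps the gap at one until it meets coordinates (2 , 1), which
      -- belong to `w` alone.
      near-w : ∀ j t → d t y ≡ suc j → d t x ≡ 2 + j → d t w ≤ j
      near-w zero t ty tx = ≤-reflexive (trans (cong (λ t → d t w) t≡w) (d-refl w))
        where
        2≢1 : 2 ≢ 1
        2≢1 ()
        ≢c : ∀ {u} → d u x ≡ 2 → u ≢ c
        ≢c ux refl = 2≢1 (trans (sym ux) cx)
        t≡w : t ≡ w
        t≡w = rep-injective (≢c tx) (≢c wx) (trans tx (sym wx)) (trans ty (sym wy))
      near-w (suc j) t ty tx with d-step ty
      ... | e , te , ey = ≤-trans (d-adjacent w te) (s≤s (near-w j e ey (trans (gap≡1 e≢y e-gap) (cong suc ey))))
        where
        e≢y : e ≢ y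
        e≢y refl with () ← trans (sym ey) (d-refl e)
        e-gap : d e y < d e x
        e-gap = subst (_≤ d e x) (cong suc (sym ey)) (≤-pred (subst (_≤ suc (d e x)) tx (d-adjacent x te)))

      -- Let `m` be the common value of `d s x` and `d t y`. For positive `m`, `near-w` puts `t`,
      -- and hence `s`, within `m - 1` of `w`, so `d s y ≤ m`, against `d s x < d s y`. For `m = 0`
      -- the two vertices are `x` and `y`, which `w` resolves.
      crossing-resolved : ∀ {s t} → d s w ≡ d t w → d s x ≡ d t y → d s x < d s y → d t y < d t x → ⊥
      crossing-resolved {s} {t} ew e s< t< with d t y in ty
      ... | zero  with refl ← d≡0⇒≡ e | refl ← d≡0⇒≡ ty
                  with () ← trans (sym wx) (trans (d-sym w s) (trans ew (trans (d-sym t w) wy)))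
      ... | suc j = <-irrefl refl (linear (d s y ∷ d s w ∷ d t w ∷ d w y ∷ j ∷ d s x ∷ [])
        (v₀ ≲ v₁ ⊕ v₃ ∷ v₁ ≲ v₂ ∷ v₃ ≲ con 1 ∷ v₂ ≲ v₄ ∷ con 1 ⊕ v₄ ≲ v₅ ∷ con 1 ⊕ v₅ ≲ v₀ ∷ []) (con 1 ≲ con 0)
        (d-triangle s w y ∷ ≤-reflexive ew ∷ ≤-reflexive wy
          ∷ near-w j t ty (trans (gap≡1 t≢y (subst (_< d t x) (sym ty) t<)) (cong suc ty))
          ∷ ≤-reflexive (sym e) ∷ s< ∷ []))
        where
        t≢y : t ≢ y
        t≢y refl with () ← trans (sym ty) (d-refl t)

      -- A pair not resolved by `c` and `w` has equal smaller coordinates, but neither equal first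
      -- nor equal second coordinates; so one member is nearer `x`, the other nearer `y`, as in
      -- `crossing-resolved`.
      absurd : ⊥
      absurd with unresolved c w
      ... | s , t , s≢t , ec , ew = cases (≤-total (d s x) (d s y)) (≤-total (d t x) (d t y))
        where
        c≢w : c ≢ w
        c≢w c≡w with () ← trans (sym cx) (trans (cong (λ u → d u x) c≡w) wx)
        w≢x : w ≢ x
        w≢x w≡x with () ← trans (sym wx) (trans (cong (λ u → d u x) w≡x) (d-refl x))
        w≢y : w ≢ y
        w≢y w≡y with () ← trans (sym wy) (trans (cong (λ u → d u y) w≡y) (d-refl y))
        x-apart : d s x ≢ d t x
        x-apart = triple-resolves s≢t c≢w c≢x w≢x ec ew
        y-apart : d s y ≢ d t y
        y-apart = triple-resolves s≢t c≢w c≢y w≢y ec ew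
        minima : d s x ⊓ d s y ≡ d t x ⊓ d t y
        minima = equal-minimum s≢t ec
        cases : d s x ≤ d s y ⊎ d s y ≤ d s x → d t x ≤ d t y ⊎ d t y ≤ d t x → ⊥
        cases (inj₁ p) (inj₁ q) = x-apart (trans (sym (m≤n⇒m⊓n≡m p)) (trans minima (m≤n⇒m⊓n≡m q)))
        cases (inj₂ p) (inj₂ q) = y-apart (trans (sym (m≥n⇒m⊓n≡n p)) (trans minima (m≥n⇒m⊓n≡n q)))
        cases (inj₁ p) (inj₂ q) = crossing-resolved ew eq
          (≤∧≢⇒< p λ e → y-apart (trans (sym e) eq)) (≤∧≢⇒< q λ e → x-apart (trans eq e))
          where eq = trans (sym (m≤n⇒m⊓n≡m p)) (trans minima (m≥n⇒m⊓n≡n q))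
        cases (inj₂ p) (inj₁ q) = crossing-resolved (sym ew) (sym eq)
          (≤∧≢⇒< q λ e → y-apart (trans eq e)) (≤∧≢⇒< p λ e → x-apart (trans (sym e) eq))
          where eq = trans (sym (m≥n⇒m⊓n≡n p)) (trans minima (m≤n⇒m⊓n≡m q))

  -- If coordinates (3 , 1) or (1 , 3) do not occur, `DegreeTwo.absurd` applies. If both occur, at
  -- `q` and `p`, then `c` and `v` fail to resolve `x , y` as well as `p , q`, against
  -- `unresolved-unique`.
  not-degree-two : ∀ c x y → x ≢ y → d c x ≡ 1 → d c y ≡ 1 → ¬ (∀ e → d c e ≡ 1 → e ≡ x ⊎ e ≡ y)
  not-degree-two c x y x≢y cx cy only-xy
    with any? (λ h → (d h x ≟ 3) ×-dec (d h y ≟ 1)) | any? (λ h → (d h y ≟ 3) ×-dec (d h x ≟ 1))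
  ... | no no-31 | _        = DegreeTwo.absurd c x y x≢y cx cy only-xy λ h hx hy → no-31 (h , hx , hy)
  ... | yes _    | no no-13 = DegreeTwo.absurd c y x (≢-sym x≢y) cy cx (λ e ce → Sum.swap (only-xy e ce))
                                λ h hy hx → no-13 (h , hy , hx)
  ... | yes (q , qx , qy) | yes (p , py , px) = excluded (unresolved-unique (≢-sym v≢c) spec-xy spec-pq)
    where
    open DegreeTwo c x y x≢y cx cy only-xy
    open PairCount
    p-v : d p v ≡ 2
    p-v = ≤-antisym
      (≤-trans (d-triangle p x v) (≤-reflexive (cong₂ _+_ px (trans (d-sym x v) vx))))
      (linear (d p v ∷ d v y ∷ d p y ∷ []) (con 3 ≲ v₂ ∷ v₂ ≲ v₀ ⊕ v₁ ∷ v₁ ≲ con 1 ∷ []) (con 2 ≲ v₀)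
        (≤-reflexive (sym py) ∷ d-triangle p v y ∷ ≤-reflexive vy ∷ []))
    q-v : d q v ≡ 2
    q-v = ≤-antisym
      (≤-trans (d-triangle q y v) (≤-reflexive (cong₂ _+_ qy (trans (d-sym y v) vy))))
      (linear (d q v ∷ d v x ∷ d q x ∷ []) (con 3 ≲ v₂ ∷ v₂ ≲ v₀ ⊕ v₁ ∷ v₁ ≲ con 1 ∷ []) (con 2 ≲ v₀)
        (≤-reflexive (sym qx) ∷ d-triangle q v x ∷ ≤-reflexive vx ∷ []))
    p≢q : p ≢ q
    p≢q refl with () ← trans (sym px) qx
    p≢c : p ≢ c
    p≢c refl with () ← trans (sym py) cy
    q≢c : q ≢ c
    q≢c refl with () ← trans (sym qx) cx
    spec-xy : Unresolved c v x y
    spec-xy = record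
      { s≢t = x≢y
      ; eqa = trans (d-sym x c) (trans cx (trans (sym cy) (d-sym c y)))
      ; eqb = trans (d-sym x v) (trans vx (trans (sym vy) (d-sym v y))) }
    spec-pq : Unresolved c v p q
    spec-pq = record
      { s≢t = p≢q
      ; eqa = trans (d-c p≢c) (trans (cong suc (trans (cong₂ _⊓_ px py) (sym (cong₂ _⊓_ qx qy)))) (sym (d-c q≢c)))
      ; eqb = trans p-v (sym q-v) }
    excluded : x ≡ p ⊎ x ≡ q → ⊥
    excluded (inj₁ refl) with () ← trans (sym px) (d-refl x)
    excluded (inj₂ refl) with () ← trans (sym qx) (d-refl x)

  opaque
    -- Without such a neighbour, `not-degree-two` applies if `a` and `b` are distinct neighbours of
    -- `c`, and `not-leaf` otherwise.
    third-neighbour : ∀ c a b → ∃[ e ] (d c e ≡ 1 × e ≢ a × e ≢ b)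
    third-neighbour c a b with any? (λ e → (d c e ≟ 1) ×-dec (¬? (e Fin.≟ a) ×-dec ¬? (e Fin.≟ b)))
    ... | yes found = found
    ... | no none = ⊥-elim (cases (d c a ≟ 1) (d c b ≟ 1) (a Fin.≟ b))
      where
      only : ∀ e → d c e ≡ 1 → e ≡ a ⊎ e ≡ b
      only e ce with e Fin.≟ a | e Fin.≟ b
      ... | yes e≡a | _       = inj₁ e≡a
      ... | no _    | yes e≡b = inj₂ e≡b
      ... | no e≢a  | no e≢b  = contradiction (e , ce , e≢a , e≢b) none
      cases : Dec (d c a ≡ 1) → Dec (d c b ≡ 1) → Dec (a ≡ b) → ⊥
      cases _ _ (yes refl) = not-leaf c a λ e ce → Sum.reduce (only e ce)
      cases (yes ca) (yes cb) (no a≢b) = not-degree-two c a b a≢b ca cb only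
      cases (no ¬ca) _ _ = not-leaf c b λ where
        e ce → Sum.[ (λ { refl → contradiction ce ¬ca }) , (λ eq → eq) ] (only e ce)
      cases _ (no ¬cb) _ = not-leaf c a λ where
        e ce → Sum.[ (λ eq → eq) , (λ { refl → contradiction ce ¬cb }) ] (only e ce)

  -- Separating pairs of vertices

  record Side (side : V → Bool) (x y : V) (b : Bool) (h : V) : Set where
    constructor side-of
    field
      ≢x   : h ≢ x
      ≢y   : h ≢ y
      on-b : side h ≡ b
  open Side

  side? : ∀ side x y b → Decidable (Side side x y b)
  side? side x y b h with h Fin.≟ x | h Fin.≟ y | side h Bool.≟ b
  ... | no nx  | no ny  | yes e = yes (side-of nx ny e)
  ... | yes ex | _      | _     = no λ s → ≢x s ex
  ... | no _   | yes ey | _     = no λ s → ≢y s ey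
  ... | no _   | no _   | no ne = no λ s → ne (on-b s)

  -- Each side is a union of components of the graph without `x` and `y`; the values of `side` at
  -- these two vertices are arbitrary.
  record Separation (x y : V) : Set where
    field
      x≢y       : x ≢ y
      side      : V → Bool
      closed    : ∀ {h z} → d h z ≡ 1 → h ≢ x → h ≢ y → z ≢ x → z ≢ y → side h ≡ side z
      inhabited : ∀ b → ∃ (Side side x y b)

    On : Bool → V → Set
    On = Side side x y

  open Separation

  transpose-side : ∀ {side x y b h} → Side side x y b h → Side side y x b h
  transpose-side (side-of nx ny e) = side-of ny nx e

  transpose : ∀ {x y} → Separation x y → Separation y x
  transpose S = record
    { x≢y       = ≢-sym (x≢y S)
    ; side      = side S
    ; closed    = λ hz hy hx zy zx → closed S hz hx hy zx zy
    ; inhabited = λ b → let h , on = inhabited S b in h , transpose-side on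
    }

  -- Two vertices of a side at the same distance from `x` differ in their distance from `y`, by
  -- `rep-unique`; `u` names the nearer one.
  record Level {x y : V} (S : Separation x y) (b : Bool) (u v : V) : Set where
    field
      on-u : On S b u
      on-v : On S b v
      eqx  : d u x ≡ d v x
      lty  : d u y < d v y
    u≢v : u ≢ v
    u≢v refl = <-irrefl refl lty
  open Level

  neighbour-on : ∀ {x y} (S : Separation x y) {b h e} → On S b h → d h e ≡ 1 → e ≢ x → e ≢ y → On S b e
  neighbour-on S on he e≢x e≢y =
    side-of e≢x e≢y (trans (sym (closed S he (≢x on) (≢y on) e≢x e≢y)) (on-b on))

  opposite-≢ : ∀ {side x y b b′ h z} → b ≢ b′ → Side side x y b h → Side side x y b′ z → h ≢ z
  opposite-≢ b≢b′ on on′ refl = b≢b′ (trans (sym (on-b on)) (on-b on′))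

  -- A geodesic from `h` to the other side must leave its own side through `x` or `y`.
  crosses : ∀ {x y} (S : Separation x y) {b b′} → b ≢ b′ → ∀ k {h z} → d h z ≡ k → On S b h → On S b′ z →
    d h x + d z x ≤ k ⊎ d h y + d z y ≤ k
  crosses S b≢b′ zero eq on on′ = contradiction (d≡0⇒≡ eq) (opposite-≢ b≢b′ on on′)
  crosses {x} {y} S b≢b′ (suc k) {h} {z} eq on on′ with d-step eq
  ... | e , he , ez with e Fin.≟ x | e Fin.≟ y
  ... | yes refl | _ = inj₁ (≤-reflexive (cong₂ _+_ he (trans (d-sym z x) ez)))
  ... | no _ | yes refl = inj₂ (≤-reflexive (cong₂ _+_ he (trans (d-sym z y) ez)))
  ... | no e≢x | no e≢y with crosses S b≢b′ k ez (neighbour-on S on he e≢x e≢y) on′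
  ... | inj₁ le = inj₁ (≤-trans (+-monoˡ-≤ (d z x) (d-adjacent x he)) (s≤s le))
  ... | inj₂ le = inj₂ (≤-trans (+-monoˡ-≤ (d z y) (d-adjacent y he)) (s≤s le))

  d-through : ∀ h z s → d h z ≤ d h s + d z s
  d-through h z s = ≤-trans (d-triangle h s z) (≤-reflexive (cong (d h s +_) (d-sym s z)))

  d-cross : ∀ {x y} (S : Separation x y) {b b′ h z} → b ≢ b′ → On S b h → On S b′ z →
    d h z ≡ (d h x + d z x) ⊓ (d h y + d z y)
  d-cross {x} {y} S {h = h} {z} b≢b′ on on′ = ≤-antisym (⊓-glb (d-through h z x) (d-through h z y))
    (Sum.[ ≤-trans (m⊓n≤m _ _) , ≤-trans (m⊓n≤n _ _) ] (crosses S b≢b′ (d h z) refl on on′))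

  true≢false : true ≢ false
  true≢false ()

  opposite : ∀ (b : Bool) → ∃[ b′ ] (b ≢ b′)
  opposite true  = false , λ ()
  opposite false = true , λ ()

  -- By `d-cross`, a vertex `z` of the other side would fail to resolve `u` and `v` along with `x`
  -- and `y`.
  rep-unique : ∀ {x y} (S : Separation x y) {b u v} → On S b u → On S b v → d u x ≡ d v x → d u y ≡ d v y → u ≡ v
  rep-unique {x} {y} S {b} {u} {v} on on′ ex ey with u Fin.≟ v
  ... | yes u≡v = u≡v
  ... | no u≢v with b′ , b≢b′ ← opposite b
               with z , onz ← inhabited S b′ =
    ⊥-elim (triple-resolves u≢v (x≢y S) (≢-sym (≢x onz)) (≢-sym (≢y onz)) ex ey
      (trans (d-cross S b≢b′ on onz) (trans (cong₂ _⊓_ (cong (_+ d z x) ex) (cong (_+ d z y) ey))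
        (sym (d-cross S b≢b′ on′ onz)))))

  -- For `h` on the side opposite to `u`, this says that some geodesic from `u` to `h` passes
  -- through `x`.
  Shadowed : V → V → V → V → Set
  Shadowed x y u h = d u x + d h x ≤ d u y + d h y

  -- As `v` is as far from `x` as `u` and farther from `y`, its geodesics to `h` can pass through
  -- `x` too.
  shadowed-equidistant : ∀ {x y} (S : Separation x y) {b b′ u v h} → b ≢ b′ → Level S b u v → On S b′ h →
    Shadowed x y u h → d u h ≡ d v h
  shadowed-equidistant {x} {y} S {u = u} {v} {h} b≢b′ uv on le =
    trans (trans (d-cross S b≢b′ (on-u uv) on) (m≤n⇒m⊓n≡m le))
      (trans (cong (_+ d h x) (eqx uv))
        (sym (trans (d-cross S b≢b′ (on-v uv) on) (m≤n⇒m⊓n≡m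
          (linear (d u x ∷ d v x ∷ d u y ∷ d v y ∷ d h x ∷ d h y ∷ [])
            (v₁ ≲ v₀ ∷ con 1 ⊕ v₂ ≲ v₃ ∷ v₀ ⊕ v₄ ≲ v₂ ⊕ v₅ ∷ []) (v₁ ⊕ v₄ ≲ v₃ ⊕ v₅)
            (≤-reflexive (sym (eqx uv)) ∷ lty uv ∷ le ∷ []))))))

  -- The vertex `x` is already equidistant from `u` and `v`, which leaves room for one more.
  shadowed-unique : ∀ {x y} (S : Separation x y) {b b′ u v h h′} → b ≢ b′ → Level S b u v → On S b′ h → On S b′ h′ →
    Shadowed x y u h → Shadowed x y u h′ → h ≡ h′
  shadowed-unique S {h = h} {h′} b≢b′ uv on on′ le le′ with h Fin.≟ h′
  ... | yes h≡h′ = h≡h′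
  ... | no h≢h′ = ⊥-elim (triple-resolves (u≢v uv) (≢-sym (≢x on)) (≢-sym (≢x on′)) h≢h′ (eqx uv)
    (shadowed-equidistant S b≢b′ uv on le) (shadowed-equidistant S b≢b′ uv on′ le′))

  level-of : ∀ {x y} (S : Separation x y) {b s t} → On S b s → On S b t → s ≢ t → d s x ≡ d t x →
    ∃₂ λ u v → Level S b u v × d u x ≡ d s x
  level-of {x} {y} S {s = s} {t} on on′ s≢t ex with <-cmp (d s y) (d t y)
  ... | tri< lt _ _ = s , t , record { on-u = on ; on-v = on′ ; eqx = ex ; lty = lt } , refl
  ... | tri≈ _ ey _ = contradiction (rep-unique S on on′ ex ey) s≢t
  ... | tri> _ _ gt = t , s , record { on-u = on′ ; on-v = on ; eqx = sym ex ; lty = gt } , sym ex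

  -- Otherwise a vertex of the side farthest from x would have degree at most two.
  opaque
    level : ∀ {x y} (S : Separation x y) b → ∃₂ (Level S b)
    level {x} {y} S b
      with t , on , farthest ← maximum (side? (side S) x y b) (λ h → d h x) (inhabited S b)
      with e , te , e≢y , _ ← third-neighbour t y y
      with e′ , te′ , e′≢y , e′≢e ← third-neighbour t y e
      = result (below te e≢y) (below te′ e′≢y)
      where
      below : ∀ {e} → d t e ≡ 1 → e ≢ y → (On S b e × d t x ≡ d e x) ⊎ (e ≢ x → On S b e) × d t x ≡ suc (d e x)
      below {e} te e≢y with d t x ≟ d e x
      ... | yes eq = inj₁ (neighbour-on S on te e≢x e≢y , eq)
        where
        e≢x : e ≢ x
        e≢x refl = ≢x on (d≡0⇒≡ (trans eq (d-refl e)))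
      ... | no ne = inj₂ ((λ e≢x → neighbour-on S on te e≢x e≢y) , ≤-antisym (d-adjacent x te) (≤∧≢⇒< le (≢-sym ne)))
        where
        le : d e x ≤ d t x
        le with e Fin.≟ x
        ... | yes refl = subst (_≤ d t x) (sym (d-refl e)) z≤n
        ... | no e≢x   = farthest (neighbour-on S on te e≢x e≢y)
      drop : ∀ {s} → (∃₂ λ u v → Level S b u v × d u x ≡ d s x) → ∃₂ (Level S b)
      drop (u , v , uv , _) = u , v , uv
      result : (On S b e × d t x ≡ d e x) ⊎ (e ≢ x → On S b e) × d t x ≡ suc (d e x) →
               (On S b e′ × d t x ≡ d e′ x) ⊎ (e′ ≢ x → On S b e′) × d t x ≡ suc (d e′ x) → ∃₂ (Level S b)
      result (inj₁ (one , eq)) _ = drop (level-of S on one (adj⇒≢ te) eq)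
      result _ (inj₁ (one′ , eq)) = drop (level-of S on one′ (adj⇒≢ te′) eq)
      result (inj₂ (one , eq)) (inj₂ (one′ , eq′)) =
        drop (level-of S (one e≢x) (one′ e′≢x) (≢-sym e′≢e) ee′)
        where
        ee′ : d e x ≡ d e′ x
        ee′ = suc-injective (trans (sym eq) eq′)
        e≢x : e ≢ x
        e≢x refl = e′≢e (d≡0⇒≡ (trans (sym ee′) (d-refl e)))
        e′≢x : e′ ≢ x
        e′≢x refl = e′≢e (sym (d≡0⇒≡ (trans ee′ (d-refl e′))))

  -- If `u′` were shadowed, so would be `v′`, which is as far from `x` and farther from `y`.
  levels-unshadowed : ∀ {x y} (S : Separation x y) {b b′ u v u′ v′} → b ≢ b′ → Level S b u v → Level S b′ u′ v′ →
    ¬ Shadowed x y u u′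
  levels-unshadowed {x} {y} S {u = u} {v} {u′} {v′} b≢b′ uv uv′ le =
    u≢v uv′ (shadowed-unique S b≢b′ uv (on-u uv′) (on-v uv′) le
      (linear (d u x ∷ d u y ∷ d u′ x ∷ d u′ y ∷ d v′ x ∷ d v′ y ∷ [])
        (v₀ ⊕ v₂ ≲ v₁ ⊕ v₃ ∷ v₄ ≲ v₂ ∷ con 1 ⊕ v₃ ≲ v₅ ∷ []) (v₀ ⊕ v₄ ≲ v₁ ⊕ v₅)
        (le ∷ ≤-reflexive (sym (eqx uv′)) ∷ lty uv′ ∷ [])))

  -- If this failed, each vertex of the other side would be shadowed by u towards x or by w towards y;
  -- as at most one vertex is shadowed either way, this leaves no room for levels on that side.
  level-gap : ∀ {x y} (S : Separation x y) {b u v w z} → Level S b u v → Level (transpose S) b w z →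
    2 + (d u y + d w x) ≤ d u x + d w y
  level-gap {x} {y} S {b} {u} {v} {w} {z} uv wz
    with b′ , b≢b′ ← opposite b
    with u′ , v′ , uv′ ← level S b′
    with w′ , z′ , wz′ ← level (transpose S) b′
    = ≮⇒≥ (crowded b≢b′ uv′ wz′)
    where
    T : Separation y x
    T = transpose S
    cover : d u x + d w y < 2 + (d u y + d w x) → ∀ h → Shadowed x y u h ⊎ Shadowed y x w h
    cover lt h with d u x + d h x ≤? d u y + d h y | d w y + d h y ≤? d w x + d h x
    ... | yes le | _      = inj₁ le
    ... | no _   | yes le = inj₂ le
    ... | no nle | no nle′ = contradiction
      (linear (d u x ∷ d u y ∷ d h x ∷ d h y ∷ d w x ∷ d w y ∷ [])
        (con 1 ⊕ (v₁ ⊕ v₃) ≲ v₀ ⊕ v₂ ∷ con 1 ⊕ (v₄ ⊕ v₂) ≲ v₅ ⊕ v₃ ∷ []) (con 2 ⊕ (v₁ ⊕ v₄) ≲ v₀ ⊕ v₅)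
        (≰⇒> nle ∷ ≰⇒> nle′ ∷ [])) (<⇒≱ lt)
    crowded : ∀ {b′ u′ v′ w′ z′} → b ≢ b′ → Level S b′ u′ v′ → Level T b′ w′ z′ →
      ¬ (d u x + d w y < 2 + (d u y + d w x))
    crowded {b′} {u′} {v′} {w′} {z′} b≢b′ uv′ wz′ lt =
      -- Since `u′` is shadowed only towards `y` and `w′` only towards `x`, uniqueness forces
      -- `v′ ≡ w′` and `z′ ≡ u′`. Then `w′` and `z′` are equally far from `x`, contrary to `wz′`.
      <-irrefl (trans (cong (λ h → d h x) (sym v′≡w′)) (trans (sym (eqx uv′)) (cong (λ h → d h x) (sym z′≡u′))))
        (lty wz′)
      where
      unique-x : ∀ {h h′} → On S b′ h → On S b′ h′ → Shadowed x y u h → Shadowed x y u h′ → h ≡ h′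
      unique-x = shadowed-unique S b≢b′ uv
      unique-y : ∀ {h h′} → On T b′ h → On T b′ h′ → Shadowed y x w h → Shadowed y x w h′ → h ≡ h′
      unique-y = shadowed-unique T b≢b′ wz
      u′-y : Shadowed y x w u′
      u′-y with cover lt u′
      ... | inj₁ s = contradiction s (levels-unshadowed S b≢b′ uv uv′)
      ... | inj₂ s = s
      w′-x : Shadowed x y u w′
      w′-x with cover lt w′
      ... | inj₁ s = s
      ... | inj₂ s = contradiction s (levels-unshadowed T b≢b′ wz wz′)
      v′≡w′ : v′ ≡ w′
      v′≡w′ with cover lt v′
      ... | inj₁ s = unique-x (on-v uv′) (transpose-side (on-u wz′)) s w′-x
      ... | inj₂ s = contradiction
        (unique-y (transpose-side (on-u uv′)) (transpose-side (on-v uv′)) u′-y s) (u≢v uv′)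
      z′≡u′ : z′ ≡ u′
      z′≡u′ with cover lt z′
      ... | inj₁ s = contradiction
        (unique-x (transpose-side (on-u wz′)) (transpose-side (on-v wz′)) w′-x s) (u≢v wz′)
      ... | inj₂ s = unique-y (on-v wz′) (transpose-side (on-u uv′)) s u′-y

  d-difference : ∀ x y h → d h x ≤ d h y + d x y
  d-difference x y h = d-through h x y

  -- Adjacent separating pairs

  module Adjacent {x y : V} (S : Separation x y) (xy : d x y ≡ 1) where

    difference≤1 : ∀ h → d h x ≤ d h y + 1
    difference≤1 h = subst (λ k → d h x ≤ d h y + k) xy (d-difference x y h)

    difference≤1ᵗ : ∀ h → d h y ≤ d h x + 1
    difference≤1ᵗ h = subst (λ k → d h y ≤ d h x + k) (trans (d-sym y x) xy) (d-difference y x h)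

    -- Coordinates differ by at most one, so a vertex nearer `x` is shadowed by the lower vertex of
    -- any level across.
    near-x-unique : ∀ {b h h′} → On S b h → On S b h′ → d h x < d h y → d h′ x < d h′ y → h ≡ h′
    near-x-unique {b} on on′ lt lt′
      with b′ , b≢b′ ← opposite b
      with u , _ , uv ← level S b′ = shadowed-unique S (≢-sym b≢b′) uv on on′ (shadowed lt) (shadowed lt′)
      where
      shadowed : ∀ {h} → d h x < d h y → Shadowed x y u h
      shadowed {h} lt = linear (d u x ∷ d u y ∷ d h x ∷ d h y ∷ [])
        (v₀ ≲ v₁ ⊕ con 1 ∷ con 1 ⊕ v₂ ≲ v₃ ∷ []) (v₀ ⊕ v₂ ≲ v₁ ⊕ v₃) (difference≤1 u ∷ lt ∷ [])

    level-near-y : ∀ {b u v} → Level S b u v → d u y < d u x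
    level-near-y {b} {u} uv with w , _ , wz ← level (transpose S) b =
      linear (d u x ∷ d u y ∷ d w x ∷ d w y ∷ []) (con 2 ⊕ (v₁ ⊕ v₂) ≲ v₀ ⊕ v₃ ∷ v₃ ≲ v₂ ⊕ con 1 ∷ [])
        (con 1 ⊕ v₁ ≲ v₀) (level-gap S uv wz ∷ difference≤1ᵗ w ∷ [])

  -- On its side `u` alone is nearer `y` than `x`; were it not adjacent to `y`, the next vertex
  -- towards `y` would be another.
  level-at-y : ∀ {x y} (S : Separation x y) → d x y ≡ 1 → ∀ {b u v} → Level S b u v → d u y ≡ 1 × d u x ≡ 2
  level-at-y {x} {y} S xy {b} {u} {v} uv = uy , ≤-antisym
      (subst (λ k → d u x ≤ k + 1) uy (A.difference≤1 u)) (subst (_< d u x) uy (A.level-near-y uv))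
    where
    module A = Adjacent S xy
    module Aᵗ = Adjacent (transpose S) (trans (d-sym y x) xy)
    uy : d u y ≡ 1
    uy with d u y in eq
    ... | zero        = contradiction (d≡0⇒≡ eq) (≢y (on-u uv))
    ... | suc zero    = refl
    ... | suc (suc k) with e , ue , ey ← d-step eq =
      contradiction (trans (sym eq) (trans (cong (λ h → d h y) (sym e≡u)) ey)) 1+n≢n
      where
      far : 2 + k ≤ d e x
      far = ≤-pred (≤-trans (subst (_< d u x) eq (A.level-near-y uv)) (d-adjacent x ue))
      e≢y : e ≢ y
      e≢y refl with () ← trans (sym ey) (d-refl e)
      e≢x : e ≢ x
      e≢x refl = contradiction (subst (2 + k ≤_) (d-refl e) far) λ ()
      e≡u : e ≡ u
      e≡u = Aᵗ.near-x-unique (transpose-side (neighbour-on S (on-u uv) ue e≢x e≢y)) (transpose-side (on-u uv))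
              (subst (_< d e x) (sym ey) far) (A.level-near-y uv)

  opaque
    -- Only `w` is nearer `x` and only `u` nearer `y`, so `v` is on the diagonal. It is adjacent to
    -- neither `x` nor `y`, so a neighbour other than `u` and `w` stays on the side and is on the
    -- diagonal as well.
    diagonal-vertices : ∀ {x y} (S : Separation x y) → d x y ≡ 1 → ∀ b →
      ∃₂ λ h e → On S b h × On S b e × h ≢ e × d h x ≡ d h y × d e x ≡ d e y
    diagonal-vertices {x} {y} S xy b
      with u , v , uv ← level S b
      with w , z , wz ← level (transpose S) b
      with e , ve , e≢u , e≢w ← third-neighbour v u w
      = v , e , on-v uv , one , adj⇒≢ ve , diagonal-v , diagonal-e
      where
      yx : d y x ≡ 1
      yx = trans (d-sym y x) xy
      module A = Adjacent S xy
      module Aᵗ = Adjacent (transpose S) yx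
      uy : d u y ≡ 1
      uy = proj₁ (level-at-y S xy uv)
      wx : d w x ≡ 1
      wx = proj₁ (level-at-y (transpose S) yx wz)
      vx : d v x ≡ 2
      vx = trans (sym (eqx uv)) (proj₂ (level-at-y S xy uv))
      2≤vy : 2 ≤ d v y
      2≤vy = subst (_< d v y) uy (lty uv)
      v≢w : v ≢ w
      v≢w refl = contradiction (trans (sym vx) wx) λ ()
      diagonal-v : d v x ≡ d v y
      diagonal-v with d v x ≟ d v y
      ... | yes eq = eq
      ... | no ne = contradiction (A.near-x-unique (on-v uv) (transpose-side (on-u wz))
                      (≤∧≢⇒< (subst (_≤ d v y) (sym vx) 2≤vy) ne) (Aᵗ.level-near-y wz)) v≢w
      not-at : ∀ {s} → 2 ≤ d v s → e ≢ s
      not-at {s} le refl = <-irrefl (sym ve) le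
      one : On S b e
      one = neighbour-on S (on-v uv) ve (not-at (≤-reflexive (sym vx))) (not-at 2≤vy)
      diagonal-e : d e x ≡ d e y
      diagonal-e with <-cmp (d e x) (d e y)
      ... | tri≈ _ eq _ = eq
      ... | tri< lt _ _ = contradiction (A.near-x-unique one (transpose-side (on-u wz)) lt (Aᵗ.level-near-y wz)) e≢w
      ... | tri> _ _ gt = contradiction
        (Aᵗ.near-x-unique (transpose-side one) (transpose-side (on-u uv)) gt (A.level-near-y uv)) e≢u

  adjacent-absurd : ∀ {x y} → Separation x y → d x y ≢ 1
  adjacent-absurd {x} {y} S xy
    with h , e , onh , one , h≢e , dh , de ← diagonal-vertices S xy true
    with z , _ , onz , _ , _ , dz , _ ← diagonal-vertices S xy false
    = triple-resolves (x≢y S) h≢e (opposite-≢ true≢false onh onz) (opposite-≢ true≢false one onz)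
        (turn dh) (turn de) (turn dz)
    where
    turn : ∀ {h} → d h x ≡ d h y → d x h ≡ d y h
    turn {h} eq = trans (d-sym x h) (trans eq (d-sym h y))

  -- Non-adjacent separating pairs

  opaque
    -- Of three neighbours of `x`, none of them `y`, two lie on the same side.
    level-at-x : ∀ {x y} (S : Separation x y) → d x y ≢ 1 → ∃[ b ] ∃₂ λ u v → Level S b u v × d u x ≡ 1
    level-at-x {x} {y} S ¬xy
      with e₁ , xe₁ , _ ← third-neighbour x x x
      with e₂ , xe₂ , e₂≢e₁ , _ ← third-neighbour x e₁ e₁
      with e₃ , xe₃ , e₃≢e₁ , e₃≢e₂ ← third-neighbour x e₁ e₂
      = pigeonhole (on xe₁) (on xe₂) (on xe₃)
      where
      on : ∀ {e} → d x e ≡ 1 → On S (side S e) e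
      on xe = side-of (≢-sym (adj⇒≢ xe)) (λ { refl → ¬xy xe }) refl
      same : ∀ {b e e′} → d x e ≡ 1 → d x e′ ≡ 1 → e ≢ e′ → On S b e → On S b e′ →
             ∃[ b ] ∃₂ λ u v → Level S b u v × d u x ≡ 1
      same {b} {e} {e′} xe xe′ e≢e′ one one′
        with u , v , uv , ux ← level-of S one one′ e≢e′ (trans (d-sym e x) (trans xe (trans (sym xe′) (d-sym x e′))))
        = b , u , v , uv , trans ux (trans (d-sym e x) xe)
      pigeonhole : ∀ {b₁ b₂ b₃} → On S b₁ e₁ → On S b₂ e₂ → On S b₃ e₃ → ∃[ b ] ∃₂ λ u v → Level S b u v × d u x ≡ 1
      pigeonhole {true}  {true}  o₁ o₂ o₃ = same xe₁ xe₂ (≢-sym e₂≢e₁) o₁ o₂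
      pigeonhole {false} {false} o₁ o₂ o₃ = same xe₁ xe₂ (≢-sym e₂≢e₁) o₁ o₂
      pigeonhole {true}  {false} {true}  o₁ o₂ o₃ = same xe₁ xe₃ (≢-sym e₃≢e₁) o₁ o₃
      pigeonhole {true}  {false} {false} o₁ o₂ o₃ = same xe₂ xe₃ (≢-sym e₃≢e₂) o₂ o₃
      pigeonhole {false} {true}  {true}  o₁ o₂ o₃ = same xe₂ xe₃ (≢-sym e₃≢e₂) o₂ o₃
      pigeonhole {false} {true}  {false} o₁ o₂ o₃ = same xe₁ xe₃ (≢-sym e₃≢e₁) o₁ o₃

  module NonAdjacent {x y : V} (S : Separation x y) {b b′ : Bool} (b≢b′ : b ≢ b′)
    {u v w z : V} (uv : Level S b u v) (ux : d u x ≡ 1) (wz : Level (transpose S) b′ w z) (wy : d w y ≡ 1)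
    where

    -- One bound is `level-gap` against any level of side `b′`, the other the triangle inequality
    -- through `w`.
    wx : suc (d w x) ≡ d x y
    wx with u′ , v′ , uv′ ← level S b′ = ≤-antisym
      (linear (d u′ x ∷ d u′ y ∷ d w x ∷ d w y ∷ d x y ∷ [])
        (con 2 ⊕ (v₁ ⊕ v₂) ≲ v₀ ⊕ v₃ ∷ v₃ ≲ con 1 ∷ v₀ ≲ v₁ ⊕ v₄ ∷ []) (con 1 ⊕ v₂ ≲ v₄)
        (level-gap S uv′ wz ∷ ≤-reflexive wy ∷ d-difference x y u′ ∷ []))
      (subst (λ k → d x y ≤ k) (trans (cong₂ _+_ (d-sym x w) wy) (+-comm (d w x) 1)) (d-triangle x w y))

    level-far : ∀ {u′ v′} → Level S b′ u′ v′ → d u′ y + d x y ≤ d u′ x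
    level-far {u′} uv′ = linear (d u′ x ∷ d u′ y ∷ d w x ∷ d w y ∷ d x y ∷ [])
      (con 2 ⊕ (v₁ ⊕ v₂) ≲ v₀ ⊕ v₃ ∷ v₃ ≲ con 1 ∷ v₄ ≲ con 1 ⊕ v₂ ∷ []) (v₁ ⊕ v₄ ≲ v₀)
      (level-gap S uv′ wz ∷ ≤-reflexive wy ∷ ≤-reflexive (sym wx) ∷ [])

    w-unique : ∀ {h} → On S b′ h → 2 + d h x ≤ d x y + d h y → h ≡ w
    w-unique {h} on le = shadowed-unique S b≢b′ uv on (transpose-side (on-u wz)) (shadowed h le)
      (shadowed w (≤-reflexive (trans (cong suc wx) (trans (+-comm 1 (d x y)) (cong (d x y +_) (sym wy))))))
      where
      shadowed : ∀ h → 2 + d h x ≤ d x y + d h y → Shadowed x y u h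
      shadowed h le = linear (d u x ∷ d u y ∷ d h x ∷ d h y ∷ d x y ∷ [])
        (v₀ ≲ con 1 ∷ con 2 ⊕ v₂ ≲ v₄ ⊕ v₃ ∷ v₄ ≲ con 1 ⊕ v₁ ∷ []) (v₀ ⊕ v₂ ≲ v₁ ⊕ v₃)
        (≤-reflexive ux ∷ le ∷ subst (λ k → d x y ≤ k + d u y) (trans (d-sym x u) ux) (d-triangle x u y) ∷ [])

    -- If `w` were at distance two or more from `x`, the next vertex towards `x` would also meet the
    -- bound in `w-unique`.
    d-xy : d x y ≡ 2
    d-xy with d w x in eq
    ... | zero        = contradiction (d≡0⇒≡ eq) (≢y (on-u wz))
    ... | suc zero    = trans (sym wx) (cong suc eq)
    ... | suc (suc k) with e , we , ex ← d-step eq =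
      contradiction (w-unique (neighbour-on S (transpose-side (on-u wz)) we e≢x e≢y) near) (≢-sym (adj⇒≢ we))
      where
      xy : d x y ≡ 3 + k
      xy = trans (sym wx) (cong suc eq)
      e≢x : e ≢ x
      e≢x refl with () ← trans (sym ex) (d-refl e)
      e≢y : e ≢ y
      e≢y refl = m≢1+n+m (suc k) {1} (trans (sym ex) (trans (d-sym e x) xy))
      near : 2 + d e x ≤ d x y + d e y
      near = ≤-trans (≤-reflexive (trans (cong (2 +_) ex) (sym xy))) (m≤m+n (d x y) (d e y))

  -- On side `b′`, only `w` has `d h x ≤ d h y` and only `p` has `d h y + 2 ≤ d h x`; all others
  -- have coordinates (j + 1 , j). The maximiser `t` is one of these, and each of its neighbours
  -- except `p` must have coordinates (j , j - 1), which at most one vertex has.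
  nonadjacent-absurd : ∀ {x y} (S : Separation x y) {b b′} → b ≢ b′ → ∀ {u v w z} →
    Level S b u v → d u x ≡ 1 → Level (transpose S) b′ w z → d w y ≡ 1 → ⊥
  nonadjacent-absurd {x} {y} S {b} {b′} b≢b′ {u} {v} {w} {z} uv ux wz wy
    with p , q , pq ← level S b′
    with f , g , fg ← level (transpose S) b
    with t , on , farthest ← maximum (side? (side S) x y b′) (λ h → d h x + d h y) (inhabited S b′)
    with e , te , e≢p , _ ← third-neighbour t p p
    with e′ , te′ , e′≢p , e′≢e ← third-neighbour t p e
    = contradiction (rep-unique S (below-on te) (below-on te′)
        (suc-injective (trans (sym (proj₁ (below te e≢p))) (proj₁ (below te′ e′≢p))))
        (suc-injective (trans (sym (proj₂ (below te e≢p))) (proj₂ (below te′ e′≢p))))) (≢-sym e′≢e)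
    where
    module N = NonAdjacent S b≢b′ uv ux wz wy
    module Nᵗ = NonAdjacent (transpose S) (≢-sym b≢b′) wz wy uv ux
    wx : d w x ≡ 1
    wx = suc-injective (trans N.wx N.d-xy)
    p-far : d p y + 2 ≤ d p x
    p-far = subst (λ k → d p y + k ≤ d p x) N.d-xy (N.level-far pq)
    p-unique : ∀ {h} → On S b′ h → d h y + 2 ≤ d h x → h ≡ p
    p-unique {h} on le = shadowed-unique (transpose S) b≢b′ fg
      (transpose-side on) (transpose-side (on-u pq)) (shadowed le) (shadowed p-far)
      where
      shadowed : ∀ {h} → d h y + 2 ≤ d h x → Shadowed y x f h
      shadowed {h} le = linear (d f x ∷ d f y ∷ d h x ∷ d h y ∷ [])
        (v₁ ≲ v₀ ⊕ con 2 ∷ v₃ ⊕ con 2 ≲ v₂ ∷ []) (v₁ ⊕ v₃ ≲ v₀ ⊕ v₂)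
        (subst (λ k → d f y ≤ d f x + k) Nᵗ.d-xy (d-difference y x f) ∷ le ∷ [])
    classify : ∀ {h} → On S b′ h → h ≢ w → h ≢ p → d h x ≡ suc (d h y)
    classify {h} on h≢w h≢p = ≤-antisym
      (≤-pred (subst (d h x <_) (+-comm (d h y) 2) (≰⇒> λ le → h≢p (p-unique on le))))
      (≰⇒> λ le → h≢w (N.w-unique on (subst (λ k → 2 + d h x ≤ k + d h y) (sym N.d-xy) (s≤s (s≤s le)))))
    3≤px : 3 ≤ d p x
    3≤px = linear (d p x ∷ d p y ∷ []) (con 1 ≲ v₁ ∷ v₁ ⊕ con 2 ≲ v₀ ∷ []) (con 3 ≲ v₀)
      (≢⇒0<d (≢y (on-u pq)) ∷ p-far ∷ [])
    q≢w : q ≢ w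
    q≢w refl = contradiction (subst (3 ≤_) (trans (eqx pq) wx) 3≤px) λ { (s≤s ()) }
    qx : d q x ≡ suc (d q y)
    qx = classify (on-v pq) q≢w (≢-sym (u≢v pq))
    q≤t : d q x + d q y ≤ d t x + d t y
    q≤t = farthest (on-v pq)
    5≤t : 5 ≤ d t x + d t y
    -- The vertex `q` already has coordinate sum at least 3 + 2. Hypotheses are listed twice where
    -- `linear` needs them with multiplicity two.
    5≤t = linear (d p x ∷ d q x ∷ d q y ∷ d t x ∷ d t y ∷ [])
      (con 3 ≲ v₀ ∷ con 3 ≲ v₀ ∷ v₀ ≲ v₁ ∷ v₀ ≲ v₁ ∷ v₁ ≲ con 1 ⊕ v₂ ∷ v₁ ⊕ v₂ ≲ v₃ ⊕ v₄ ∷ []) (con 5 ≲ v₃ ⊕ v₄)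
      (3≤px ∷ 3≤px ∷ ≤-reflexive (eqx pq) ∷ ≤-reflexive (eqx pq) ∷ ≤-reflexive qx ∷ q≤t ∷ [])
    t≢w : t ≢ w
    t≢w refl = contradiction (subst (5 ≤_) (cong₂ _+_ wx wy) 5≤t) λ { (s≤s (s≤s ())) }
    t≢p : t ≢ p
    t≢p refl = <-irrefl refl (≤-trans (+-mono-≤-< (≤-reflexive (eqx pq)) (lty pq)) q≤t)
    tx : d t x ≡ suc (d t y)
    tx = classify on t≢w t≢p
    2≤ty : 2 ≤ d t y
    2≤ty = ≮⇒≥ λ { (s≤s ty≤1) → <⇒≱ {3} {5} (s≤s (s≤s (s≤s (s≤s z≤n)))) (linear (d t x ∷ d t y ∷ [])
      (con 5 ≲ v₀ ⊕ v₁ ∷ v₀ ≲ con 1 ⊕ v₁ ∷ v₁ ≲ con 1 ∷ v₁ ≲ con 1 ∷ []) (con 5 ≲ con 3)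
      (5≤t ∷ ≤-reflexive tx ∷ ty≤1 ∷ ty≤1 ∷ [])) }
    3≤tx : 3 ≤ d t x
    3≤tx = subst (3 ≤_) (sym tx) (s≤s 2≤ty)
    not-at : ∀ {e s} → d t e ≡ 1 → 2 ≤ d t s → e ≢ s
    not-at te le refl = <-irrefl (sym te) le
    below-on : ∀ {e} → d t e ≡ 1 → On S b′ e
    below-on te = neighbour-on S on te (not-at te (≤-trans (n≤1+n 2) 3≤tx)) (not-at te 2≤ty)
    below : ∀ {e} → d t e ≡ 1 → e ≢ p → d t x ≡ suc (d e x) × d t y ≡ suc (d e y)
    below {e} te e≢p = trans tx (trans (cong suc ty) (cong suc (sym ex))) , ty
      where
      e≢w : e ≢ w
      e≢w refl = <-irrefl refl (≤-trans 3≤tx (subst (λ k → d t x ≤ suc k) wx (d-adjacent x te)))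
      ex : d e x ≡ suc (d e y)
      ex = classify (below-on te) e≢w e≢p
      ey≤ty : d e y ≤ d t y
      ey≤ty = ≮⇒≥ λ lt → <-irrefl refl (linear (d e x ∷ d e y ∷ d t x ∷ d t y ∷ [])
        (v₀ ⊕ v₁ ≲ v₂ ⊕ v₃ ∷ con 1 ⊕ v₁ ≲ v₀ ∷ v₂ ≲ con 1 ⊕ v₃ ∷ con 1 ⊕ v₃ ≲ v₁ ∷ con 1 ⊕ v₃ ≲ v₁ ∷ [])
        (con 1 ≲ con 0) (farthest (below-on te) ∷ ≤-reflexive (sym ex) ∷ ≤-reflexive tx ∷ lt ∷ lt ∷ []))
      ty : d t y ≡ suc (d e y)
      ty = ≤-antisym (d-adjacent y te) (≤∧≢⇒< ey≤ty λ eq →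
        adj⇒≢ te (rep-unique S on (below-on te) (trans tx (trans (cong suc (sym eq)) (sym ex))) (sym eq)))

  no-separation : ∀ {x y} → ¬ Separation x y
  no-separation {x} {y} S
    with b , u , v , uv , ux ← level-at-x S (adjacent-absurd S)
    with b′ , w , z , wz , wy ← level-at-x (transpose S) (adjacent-absurd (transpose S))
    with b Bool.≟ b′
  ... | no b≢b′  = nonadjacent-absurd S b≢b′ uv ux wz wy
  -- On a common side, `level-gap` would give `d u y` the value zero.
  ... | yes refl = <-irrefl refl (≤-trans (s≤s (≢⇒0<d (≢y (on-u uv))))
    (linear (d u x ∷ d u y ∷ d w x ∷ d w y ∷ [])
      (con 2 ⊕ (v₁ ⊕ v₂) ≲ v₀ ⊕ v₃ ∷ v₀ ≲ con 1 ∷ v₃ ≲ con 1 ∷ []) (con 1 ⊕ v₁ ≲ con 1)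
      (level-gap S uv wz ∷ ≤-reflexive ux ∷ ≤-reflexive wy ∷ [])))

-- From graphs to their metrics

-- Over a finite domain double negation moves out of the quantifier, so all choices can be assumed
-- at once for a stable goal.
¬¬-∀ : ∀ {n} {P : Fin n → Set} → (∀ i → ¬ ¬ P i) → ¬ ¬ (∀ i → P i)
¬¬-∀ {zero}  ps k = k λ ()
¬¬-∀ {suc n} ps k = ps zero λ p₀ → ¬¬-∀ (ps ∘ suc) λ p₊ → k λ { zero → p₀ ; (suc i) → p₊ i }

-- Subsets of at most three elements

⁅⁆∪-< : ∀ {n} {a : Fin n} {p : Subset n} → a ∉ p → ∣ p ∣ < ∣ ⁅ a ⁆ ∪ p ∣
⁅⁆∪-< {a = a} {p} a∉p = p⊂q⇒∣p∣<∣q∣ (q⊆p∪q ⁅ a ⁆ p , a , p⊆p∪q p (x∈⁅x⁆ a) , a∉p)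

∣p∪q∣≤∣p∣+∣q∣ : ∀ {n} (p q : Subset n) → ∣ p ∪ q ∣ ≤ ∣ p ∣ + ∣ q ∣
∣p∪q∣≤∣p∣+∣q∣ []          []          = z≤n
∣p∪q∣≤∣p∣+∣q∣ (true ∷ p)  (true ∷ q)  =
  s≤s (≤-trans (∣p∪q∣≤∣p∣+∣q∣ p q) (+-monoʳ-≤ ∣ p ∣ (n≤1+n ∣ q ∣)))
∣p∪q∣≤∣p∣+∣q∣ (true ∷ p)  (false ∷ q) = s≤s (∣p∪q∣≤∣p∣+∣q∣ p q)
∣p∪q∣≤∣p∣+∣q∣ (false ∷ p) (true ∷ q)  =
  ≤-trans (s≤s (∣p∪q∣≤∣p∣+∣q∣ p q)) (≤-reflexive (sym (+-suc ∣ p ∣ ∣ q ∣)))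
∣p∪q∣≤∣p∣+∣q∣ (false ∷ p) (false ∷ q) = ∣p∪q∣≤∣p∣+∣q∣ p q

doubleton : ∀ {n} → Fin n → Fin n → Subset n
doubleton a b = ⁅ a ⁆ ∪ ⁅ b ⁆

tripleton : ∀ {n} → Fin n → Fin n → Fin n → Subset n
tripleton a b c = ⁅ a ⁆ ∪ doubleton b c

∈-doubleton⁻ : ∀ {n} {a b x : Fin n} → x ∈ doubleton a b → x ≡ a ⊎ x ≡ b
∈-doubleton⁻ x∈ = Sum.map (x∈⁅y⁆⇒x≡y _) (x∈⁅y⁆⇒x≡y _) (x∈p∪q⁻ _ _ x∈)

∈-tripleton⁻ : ∀ {n} {a b c x : Fin n} → x ∈ tripleton a b c → x ≡ a ⊎ x ≡ b ⊎ x ≡ c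
∈-tripleton⁻ x∈ = Sum.map (x∈⁅y⁆⇒x≡y _) ∈-doubleton⁻ (x∈p∪q⁻ _ _ x∈)

∣doubleton∣≤2 : ∀ {n} (a b : Fin n) → ∣ doubleton a b ∣ ≤ 2
∣doubleton∣≤2 a b = ≤-trans (∣p∪q∣≤∣p∣+∣q∣ ⁅ a ⁆ ⁅ b ⁆) (≤-reflexive (cong₂ _+_ (∣⁅x⁆∣≡1 a) (∣⁅x⁆∣≡1 b)))

∣tripleton∣≡3 : ∀ {n} {a b c : Fin n} → a ≢ b → a ≢ c → b ≢ c → ∣ tripleton a b c ∣ ≡ 3
∣tripleton∣≡3 {a = a} {b} {c} a≢b a≢c b≢c = ≤-antisym
  (≤-trans (∣p∪q∣≤∣p∣+∣q∣ ⁅ a ⁆ (doubleton b c)) (+-mono-≤ (≤-reflexive (∣⁅x⁆∣≡1 a)) (∣doubleton∣≤2 b c)))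
  (≤-trans (s≤s (subst (_< ∣ doubleton b c ∣) (∣⁅x⁆∣≡1 c) (⁅⁆∪-< (b≢c ∘ x∈⁅y⁆⇒x≡y c))))
    (⁅⁆∪-< (Sum.[ a≢b , a≢c ] ∘ ∈-doubleton⁻)))

three-members : ∀ {n} {p : Subset n} {a b c} → a ≢ b → a ≢ c → b ≢ c → a ∈ p → b ∈ p → c ∈ p → 3 ≤ ∣ p ∣
three-members {p = p} {a} {b} {c} a≢b a≢c b≢c a∈p b∈p c∈p =
  subst (_≤ ∣ p ∣) (∣tripleton∣≡3 a≢b a≢c b≢c)
    (p⊆q⇒∣p∣≤∣q∣ {p = tripleton a b c} (members ∘ ∈-tripleton⁻))
  where
  members : ∀ {x} → x ≡ a ⊎ x ≡ b ⊎ x ≡ c → x ∈ p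
  members (inj₁ refl)        = a∈p
  members (inj₂ (inj₁ refl)) = b∈p
  members (inj₂ (inj₂ refl)) = c∈p

∉∈⇒≢ : ∀ {n} {p : Subset n} {a b} → a ∉ p → b ∈ p → a ≢ b
∉∈⇒≢ a∉p b∈p refl = a∉p b∈p

-- The spare vertices `p` and `q` fill `S` up to two elements; `q` steps in when `p` is the sole
-- element of `S`.
cover-by-two : ∀ {n} (S : Subset n) {u v p q : Fin n} → ¬ 3 ≤ ∣ S ∣ → u ∉ S → v ∉ S →
  p ≢ q → p ≢ u → p ≢ v → q ≢ u → q ≢ v →
  ∃₂ λ x y → x ≢ y × (u ≢ x × u ≢ y) × (v ≢ x × v ≢ y) × (∀ {s} → s ≢ x → s ≢ y → s ∉ S)
cover-by-two S {u} {v} {p} {q} ¬3≤ u∉S v∉S p≢q p≢u p≢v q≢u q≢v with any? (_∈? S)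
... | no empty = p , q , p≢q , (≢-sym p≢u , ≢-sym q≢u) , (≢-sym p≢v , ≢-sym q≢v) , λ _ _ s∈S → empty (_ , s∈S)
... | yes (x , x∈S) with any? (λ y → (y ∈? S) ×-dec ¬? (x Fin.≟ y))
... | yes (y , y∈S , x≢y) = x , y , x≢y , (∉∈⇒≢ u∉S x∈S , ∉∈⇒≢ u∉S y∈S) , (∉∈⇒≢ v∉S x∈S , ∉∈⇒≢ v∉S y∈S) ,
      λ s≢x s≢y s∈S → ¬3≤ (three-members x≢y (≢-sym s≢x) (≢-sym s≢y) x∈S y∈S s∈S)
... | no single with x Fin.≟ p
... | no x≢p = x , p , x≢p , (∉∈⇒≢ u∉S x∈S , ≢-sym p≢u) , (∉∈⇒≢ v∉S x∈S , ≢-sym p≢v) ,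
      λ s≢x _ s∈S → single (_ , s∈S , ≢-sym s≢x)
... | yes refl = x , q , p≢q , (≢-sym p≢u , ≢-sym q≢u) , (≢-sym p≢v , ≢-sym q≢v) ,
      λ s≢x _ s∈S → single (_ , s∈S , ≢-sym s≢x)

-- Walks, geodesics and small separators

module _ (G : Graph) where

  private
    V : Set
    V = Fin (order G)

  infixr 5 _++ʷ_
  _++ʷ_ : ∀ {u v w k l} → Walk G u v k → Walk G v w l → Walk G u w (k + l)
  nil      ++ʷ q = q
  cons a p ++ʷ q = cons a (p ++ʷ q)

  reverse : ∀ {u v k} → Walk G u v k → Walk G v u k
  reverse nil                    = nil
  reverse {u} {v} (cons {k = k} a p) =
    subst (Walk G v u) (+-comm k 1) (reverse p ++ʷ cons (Adj-sym G a) nil)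

  ¬¬-geodesic : Connected G → ∀ u v → ¬ ¬ ∃ (Dist G u v)
  ¬¬-geodesic connected u v none = let k , p = connected u v in
    <-rec (λ k → ¬ Walk G u v k) (λ k shorter p → none (k , p , λ m m<k → shorter m<k)) k p

  snoc : ∀ {S u v w} → WalkAvoid G S u v → Adj G v w → w ∉ S → WalkAvoid G S u w
  snoc (nil u∉S)      a w∉S = cons u∉S a (nil w∉S)
  snoc (cons u∉S b p) a w∉S = cons u∉S b (snoc p a w∉S)

  module Geodesics (geodesic : ∀ u v → ∃ (Dist G u v)) where

    d : V → V → ℕ
    d u v = proj₁ (geodesic u v)

    d-walk : ∀ u v → Walk G u v (d u v)
    d-walk u v = proj₁ (proj₂ (geodesic u v))

    d-minimal : ∀ {u v k} → Walk G u v k → d u v ≤ k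
    d-minimal {u} {v} {k} p = ≮⇒≥ λ k<d → proj₂ (proj₂ (geodesic u v)) k k<d p

    Dist-d : ∀ {u v k} → Dist G u v k → d u v ≡ k
    Dist-d {u} {v} (p , minimal) = ≤-antisym (d-minimal p) (≮⇒≥ λ d<k → minimal (d u v) d<k (d-walk u v))

    d-refl : ∀ u → d u u ≡ 0
    d-refl u = n≤0⇒n≡0 (d-minimal nil)

    d≡0⇒≡ : ∀ {u v} → d u v ≡ 0 → u ≡ v
    d≡0⇒≡ {u} {v} eq with nil ← subst (Walk G u v) eq (d-walk u v) = refl

    d-sym : ∀ u v → d u v ≡ d v u
    d-sym u v = ≤-antisym (d-minimal (reverse (d-walk v u))) (d-minimal (reverse (d-walk u v)))

    d-triangle : ∀ u v w → d u w ≤ d u v + d v w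
    d-triangle u v w = d-minimal (d-walk u v ++ʷ d-walk v w)

    Adj⇒d≡1 : ∀ {u v} → Adj G u v → d u v ≡ 1
    Adj⇒d≡1 {u} {v} a = ≤-antisym (d-minimal (cons a nil))
      (n≢0⇒n>0 λ eq → irrefl G (subst (Adj G u) (sym (d≡0⇒≡ eq)) a))

    d≡1⇒Adj : ∀ {u v} → d u v ≡ 1 → Adj G u v
    d≡1⇒Adj {u} {v} eq with cons a nil ← subst (Walk G u v) eq (d-walk u v) = a

    d-step : ∀ {u v k} → d u v ≡ suc k → ∃[ w ] (d u w ≡ 1 × d w v ≡ k)
    d-step {u} {v} {k} eq with cons {w = w} a p ← subst (Walk G u v) eq (d-walk u v) =
      w , Adj⇒d≡1 a , ≤-antisym (d-minimal p)
        (≤-pred (subst (_≤ suc (d w v)) eq (subst (λ j → d u v ≤ j + d w v) (Adj⇒d≡1 a) (d-triangle u w v))))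

    equidistant⇒SameDist : ∀ {u v w} → d u w ≡ d v w → SameDist G u v w
    equidistant⇒SameDist {u} {v} {w} eq =
      d u w , proj₂ (geodesic u w) , subst (Dist G v w) (sym eq) (proj₂ (geodesic v w))

    SameDist⇒equidistant : ∀ {u v w} → SameDist G u v w → d u w ≡ d v w
    SameDist⇒equidistant (_ , p , q) = trans (Dist-d p) (sym (Dist-d q))

    module _ (randomly : RandomlyDim G 3) where

      triple-resolves : ∀ {u v a b c} → u ≢ v → a ≢ b → a ≢ c → b ≢ c →
        d u a ≡ d v a → d u b ≡ d v b → d u c ≡ d v c → ⊥
      triple-resolves {u} {v} {a} {b} {c} u≢v a≢b a≢c b≢c ea eb ec =
        proj₁ (proj₂ randomly (tripleton a b c) (∣tripleton∣≡3 a≢b a≢c b≢c)) u v u≢v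
          λ w w∈ → equidistant⇒SameDist (members (∈-tripleton⁻ w∈))
        where
        members : ∀ {w} → w ≡ a ⊎ w ≡ b ⊎ w ≡ c → d u w ≡ d v w
        members (inj₁ refl)        = ea
        members (inj₂ (inj₁ refl)) = eb
        members (inj₂ (inj₂ refl)) = ec

      -- A doubleton, degenerate or not, is smaller than a basis.
      unresolved : ∀ a b → ∃₂ λ u v → u ≢ v × d u a ≡ d v a × d u b ≡ d v b
      unresolved a b with any? (λ u → any? λ v → ¬? (u Fin.≟ v) ×-dec ((d u a ≟ d v a) ×-dec (d u b ≟ d v b)))
      ... | yes found = found
      ... | no none with W , (_ , minimal) , ∣W∣≡3 ← proj₁ randomly =
        contradiction (≤-trans (subst (_≤ ∣ doubleton a b ∣) ∣W∣≡3 (minimal (doubleton a b) resolving))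
          (∣doubleton∣≤2 a b)) 1+n≰n
        where
        resolving : Resolving G (doubleton a b)
        resolving u v u≢v same = none (u , v , u≢v
          , SameDist⇒equidistant (same a (x∈p∪q⁺ (inj₁ (x∈⁅x⁆ a))))
          , SameDist⇒equidistant (same b (x∈p∪q⁺ (inj₂ (x∈⁅x⁆ b)))))

      open RandomlyThreeDimensional d d-refl d≡0⇒≡ d-sym d-triangle d-step triple-resolves unresolved
        using (Separation; side-of; no-separation; equidistant-≢)

      no-small-separator : ∀ {S u v} → ¬ 3 ≤ ∣ S ∣ → u ∉ S → v ∉ S → ¬ WalkAvoid G S u v →
        (∀ w → Dec (WalkAvoid G S u w)) → ⊥
      no-small-separator {S} {u} {v} ¬3≤ u∉S v∉S separated reach?
        -- Distinct vertices equidistant from `u` and from `v` differ from both, so they can serve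
        -- as the spare vertices.
        with p , q , p≢q , pu , pv ← unresolved u v
        with x , y , x≢y , (u≢x , u≢y) , (v≢x , v≢y) , outside ← cover-by-two S ¬3≤ u∉S v∉S p≢q
               (equidistant-≢ p≢q pu) (equidistant-≢ p≢q pv)
               (equidistant-≢ (≢-sym p≢q) (sym pu)) (equidistant-≢ (≢-sym p≢q) (sym pv))
        = no-separation {x} {y} record
          { x≢y       = x≢y
          ; side      = side
          ; closed    = λ hz h≢x h≢y z≢x z≢y →
              let a = d≡1⇒Adj hz
              in side-cong (λ r → snoc r a (outside z≢x z≢y)) (λ r → snoc r (Adj-sym G a) (outside h≢x h≢y))
          ; inhabited = λ where
              true  → u , side-of u≢x u≢y (dec-true (reach? u) (nil u∉S))
              false → v , side-of v≢x v≢y (dec-false (reach? v) separated)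
          }
        where
        side : V → Bool
        -- Reachability avoids only `S`, so walks may use an added `x` or `y`; adjacency away from
        -- these two still preserves it, as all other vertices lie outside `S`.
        side w = does (reach? w)
        side-cong : ∀ {h z} → (WalkAvoid G S u h → WalkAvoid G S u z) → (WalkAvoid G S u z → WalkAvoid G S u h) →
          side h ≡ side z
        side-cong {h} {z} to from with reach? h
        ... | yes r = sym (dec-true (reach? z) (to r))
        ... | no ¬r = sym (dec-false (reach? z) (¬r ∘ from))

mainTheorem6 : (G : Graph) → Connected G → RandomlyDim G 3 → KConnected G 3
mainTheorem6 G connected randomly S (u , v , u∉S , v∉S , separated) = decidable-stable (3 ≤? ∣ S ∣) λ ¬3≤ →
  ¬¬-∀ (λ u → ¬¬-∀ (¬¬-geodesic G connected u)) λ geodesic →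
  ¬¬-∀ (λ _ → ¬¬-excluded-middle) λ reach? →
  Geodesics.no-small-separator G geodesic randomly ¬3≤ u∉S v∉S separated reach?
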